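{- Let $G$ be a finite bipartite graph with bipartition $(X,Y)$ and let $G^+$ be its auxiliary graph. Then $G$ is a cocomparability bigraph if and only if $G^+$ is bipartite. Moreover, if $G^+$ is not bipartite, then any odd cycle of $G^+$ yields a weak edge-asteroid of $G$.
   Context: Let $\mathcal F$ be the set of ordered pairs $(u,v)$ of distinct vertices both in $X$ or both in $Y$. Two edges $xy,x'y'$ ($x,x'\in X$, $y,y'\in Y$) are independent if they are disjoint and $xy'\notin E(G)$, $x'y\notin E(G)$. The auxiliary graph $G^+$ has vertex set $\mathcal F$, in which $(u,v)$ is adjacent to $(v,u)$ and to every $(z,w)\in\mathcal F$ such that $uw$ and $vz$ are independent edges of $G$. $G$ is a cocomparability bigraph if there exist linear orderings $\prec_X$ of $X$ and $\prec_Y$ of $Y$ such that for all $u,v\in X$, $w,z\in Y$ with $u\prec_X v$, $w\prec_Y z$ and $uz,vw\in E(G)$, at least one of $uw,vz$ is in $E(G)$. A weak edge-asteroid in $G$ is a family of $2k+1$ ($k\ge1$) edges $e_0,\dots,e_{2k}$, not necessarily distinct, such that for each $i$ there is a walk containing both end vertices of $e_{i+k}$ and both end vertices of $e_{i+k+1}$ and no vertex adjacent to an end vertex of $e_i$ (indices mod $2k+1$). -}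

module Defs where

open import Level using (0ℓ)
open import Data.Nat using (ℕ; zero; suc; _+_; _≤_; NonZero)
open import Data.Nat.DivMod using (_%_; m%n<n)
open import Data.Fin using (Fin; toℕ; fromℕ<)
open import Data.Bool using (Bool; T)
open import Data.Product using (Σ; ∃; ∃-syntax; _×_; _,_)
open import Data.Sum using (_⊎_; inj₁; inj₂)
open import Data.Empty using (⊥)
open import Data.List using (List; []; _∷_)
open import Data.List.Membership.Propositional using (_∈_)
open import Relation.Nullary using (¬_)
open import Relation.Binary.PropositionalEquality using (_≡_; _≢_)
open import Relation.Binary.Structures using (IsStrictTotalOrder)

_⊕_ : ∀ {N} .{{_ : NonZero N}} → Fin N → ℕ → Fin N
_⊕_ {N} i j = fromℕ< (m%n<n (toℕ i + j) N)

-- A finite bipartite graph G with bipartition (X, Y), X = Fin m, Y = Fin n,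
-- given by its (decidable) edge relation  E x y = true  iff  xy ∈ E(G).
module _ {m n : ℕ} (E : Fin m → Fin n → Bool) where

  Edge : Fin m → Fin n → Set
  Edge x y = T (E x y)

  Independent : Fin m → Fin n → Fin m → Fin n → Set
  Independent x y x' y' =
    Edge x y × Edge x' y' × x ≢ x' × y ≢ y' × ¬ Edge x y' × ¬ Edge x' y

  -- Ordered pairs of vertices both in X or both in Y
  -- (the set 𝓕 consists of those with distinct entries, see InF).
  data Pair : Set where
    pX : Fin m → Fin m → Pair
    pY : Fin n → Fin n → Pair

  InF : Pair → Set
  InF (pX u v) = u ≢ v
  InF (pY u v) = u ≢ v

  swap : Pair → Pair
  swap (pX u v) = pX v u
  swap (pY u v) = pY v u

  IndepAdj : Pair → Pair → Set
  IndepAdj (pX u v) (pY z w) = Independent u w v z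
  IndepAdj (pY u v) (pX z w) = Independent w u z v
  IndepAdj _ _ = ⊥

  Adj⁺ : Pair → Pair → Set
  Adj⁺ a b = (InF a × InF b × b ≡ swap a) ⊎ (InF a × InF b × IndepAdj a b)

  -- G⁺ is bipartite: it has a proper 2-colouring
  -- (colours of pairs outside 𝓕 are irrelevant: they have no neighbours)
  Bipartite⁺ : Set
  Bipartite⁺ = Σ (Pair → Bool) λ c → ∀ a b → Adj⁺ a b → c a ≢ c b

  record OddCycle⁺ : Set where
    field
      k        : ℕ
      k≥1      : 1 ≤ k
      vert     : Fin (suc (k + k)) → Pair
      injective : ∀ i j → vert i ≡ vert j → i ≡ j
      adjacent : ∀ i → Adj⁺ (vert i) (vert (i ⊕ 1))

  CocomparabilityBigraph : Set₁
  CocomparabilityBigraph =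
    Σ (Fin m → Fin m → Set) λ _≺X_ →
    Σ (Fin n → Fin n → Set) λ _≺Y_ →
      IsStrictTotalOrder _≡_ _≺X_ × IsStrictTotalOrder _≡_ _≺Y_ ×
      (∀ u v w z → u ≺X v → w ≺Y z → Edge u z → Edge v w →
         Edge u w ⊎ Edge v z)

  VG : Set
  VG = Fin m ⊎ Fin n

  AdjG : VG → VG → Set
  AdjG (inj₁ x) (inj₂ y) = Edge x y
  AdjG (inj₂ y) (inj₁ x) = Edge x y
  AdjG _ _ = ⊥

  data IsWalk : List VG → Set where
    single : ∀ a → IsWalk (a ∷ [])
    step   : ∀ {a b rest} → AdjG a b → IsWalk (b ∷ rest) → IsWalk (a ∷ b ∷ rest)

  EdgeOf : Set
  EdgeOf = Σ (Fin m × Fin n) λ { (x , y) → Edge x y }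

  Covers : List VG → EdgeOf → Set
  Covers ws ((x , y) , _) = inj₁ x ∈ ws × inj₂ y ∈ ws

  Avoids : List VG → EdgeOf → Set
  Avoids ws ((x , y) , _) =
    ∀ v → v ∈ ws → ¬ AdjG v (inj₁ x) × ¬ AdjG v (inj₂ y)

  -- a weak edge-asteroid: edges e 0, …, e 2k (k ≥ 1, not necessarily distinct)
  record WeakEdgeAsteroid : Set where
    field
      k     : ℕ
      k≥1   : 1 ≤ k
      e     : Fin (suc (k + k)) → EdgeOf
      walk  : ∀ i → ∃[ ws ] (IsWalk ws × Covers ws (e (i ⊕ k))
                        × Covers ws (e (i ⊕ suc k)) × Avoids ws (e i))

{-# OPTIONS --safe #-}

-- A 2-colouring of G⁺ is a choice of one pair from each {(u,v), (v,u)}, i.e. a tournament on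
-- X and one on Y, in which independent edges never cross; only transitivity may fail.
-- Pairs of vertices with comparable neighbourhoods are isolated in G⁺ up to reversal; ordering
-- them by inclusion keeps them out of every cyclic triangle.  A cyclic triangle a → b → c → a
-- of the remaining pairs survives replacing (b,c) by any pair (x,y) of the same class,
-- with a fixed.  Orient every class by a representative (x,y) in X whose first entry x is least
-- among the vertices of the class.  For a cyclic triangle in X whose vertex a is minimal,
-- replace (c,a) by its representative (x,y): since x ≤ a, minimality gives x = a, and b → x
-- contradicts a → b.
--
-- An odd cycle of G⁺ joins a pair to its reversal by a walk of parallel pairs, whose first
-- entries followed by its second entries form a closed walk g₀, …, g₂ᵣ₋₁ of edges of G in
-- which gᵢ and gᵢ₊ᵣ are independent.  Then g₁, …, g₂ᵣ₋₁ is a weak edge-asteroid.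
module Submission where

open import Defs
open import Data.Nat using (ℕ; zero; suc; _+_; z≤n; s≤s)
import Data.Nat as ℕ
import Data.Nat.Properties as ℕ
open import Data.Nat.DivMod using (_%_; m%n<n; m%n%n≡m%n; n%n≡0; m<n⇒m%n≡m; m≤n⇒[n∸m]%m≡n%m;
  %-distribˡ-+)
open import Data.Nat.Solver using (module +-*-Solver)
open import Data.Nat.Induction using (<-wellFounded)
open import Induction.WellFounded using (Acc; acc)
open import Data.Fin using (Fin; toℕ; fromℕ<)
import Data.Fin as Fin
import Data.Fin.Properties as Fin
import Data.Bool as Bool
open import Data.Bool using (Bool)
open import Data.Bool.Properties using (T?; ¬-not)
open import Data.Product using (Σ; ∃-syntax; _×_; _,_; proj₁; proj₂) renaming (swap to swap×)
open import Data.Sum using (_⊎_; inj₁; inj₂)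
open import Data.List as List using (List; []; _∷_; _++_; allFin; filter; cartesianProduct;
  cartesianProductWith)
open import Data.List.Membership.Propositional using (_∈_)
open import Data.List.Membership.Propositional.Properties using (∈-allFin; ∈-map⁺; ∈-++⁺ˡ;
  ∈-++⁺ʳ; ∈-filter⁺; ∈-cartesianProduct⁺; ∈-cartesianProductWith⁺)
open import Data.List.Relation.Unary.Any using (here; there)
open import Data.List.Relation.Unary.All as All using (All; []; _∷_)
open import Data.List.Relation.Unary.All.Properties using (all-filter)
open import Data.Empty using (⊥; ⊥-elim)
open import Function using (flip; _∘_)
open import Function.Bundles using (_⇔_; mk⇔)
open import Relation.Nullary using (¬_; Dec; yes; no; does; ¬?; _×-dec_; _⊎-dec_; decidable-stable)
open import Relation.Binary.Definitions using (DecidableEquality; Tri; tri<; tri≈; tri>;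
  Trichotomous)
open import Relation.Binary.Structures.Biased using (isStrictTotalOrderᶜ)
open import Relation.Binary.Structures using (IsEquivalence; IsStrictTotalOrder)
open import Relation.Binary.PropositionalEquality
open import Relation.Binary.Construct.Closure.ReflexiveTransitive as Star using (Star; ε; _◅_;
  _◅◅_; gmap; reverse)

open +-*-Solver using (solve; _:+_; _:=_; con)

private variable
  m n : ℕ

-- Independent edges, parallel pairs and private neighbours.

independent : (E : Fin m → Fin n → Bool) → ∀ {x y x' y'} → Edge E x y → Edge E x' y' →
  ¬ Edge E x y' → ¬ Edge E x' y → Independent E x y x' y'
independent E xy x'y' ¬xy' ¬x'y =
  xy , x'y' , (λ { refl → ¬x'y xy }) , (λ { refl → ¬xy' xy }) , ¬xy' , ¬x'y

independent-flip : (E : Fin m → Fin n → Bool) → ∀ {x y x' y'} →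
  Independent E x y x' y' → Independent (flip E) y x y' x'
independent-flip E (xy , x'y' , x≢x' , y≢y' , ¬xy' , ¬x'y) =
  xy , x'y' , y≢y' , x≢x' , ¬x'y , ¬xy'

independent-sym : (E : Fin m → Fin n → Bool) → ∀ {x y x' y'} →
  Independent E x y x' y' → Independent E x' y' x y
independent-sym E (xy , x'y' , x≢x' , y≢y' , ¬xy' , ¬x'y) =
  x'y' , xy , x≢x' ∘ sym , y≢y' ∘ sym , ¬x'y , ¬xy'

-- p and q are ordered the same way by every pair of orderings witnessing that G is a
-- cocomparability bigraph.
Parallel : (E : Fin m → Fin n → Bool) → Pair E → Pair E → Set
Parallel E p q = IndepAdj E p (swap E q)

-- The negation is the inclusion N(u) ⊆ N(v). Excess both ways means exactly that `u` and `v` are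
-- ends of two independent edges.
Excess : (E : Fin m → Fin n → Bool) → Fin m → Fin m → Set
Excess E u v = ∃[ w ] (Edge E u w × ¬ Edge E v w)

excess? : (E : Fin m → Fin n → Bool) → ∀ u v → Dec (Excess E u v)
excess? E u v = Fin.any? λ w → T? (E u w) ×-dec ¬? (T? (E v w))

¬excess⇒⊆ : (E : Fin m → Fin n → Bool) → ∀ {u v w} → ¬ Excess E u v → Edge E u w → Edge E v w
¬excess⇒⊆ E {v = v} {w} ¬uv uw = decidable-stable (T? (E v w)) λ ¬vw → ¬uv (w , uw , ¬vw)

independent⇒excess : (E : Fin m → Fin n → Bool) → ∀ {x y x' y'} →
  Independent E x y x' y' → Excess E x x' × Excess E x' x
independent⇒excess E {y = y} {y' = y'} (xy , x'y' , _ , _ , ¬xy' , ¬x'y) =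
  (y , xy , ¬x'y) , (y' , x'y' , ¬xy')

excess⇒≢ : (E : Fin m → Fin n → Bool) → ∀ {u v} → Excess E u v → u ≢ v
excess⇒≢ E (_ , uw , ¬vw) refl = ¬vw uw

-- What holds of the two orders before transitivity is known. The conditions are symmetric in X and
-- Y, so by `oriented-flip` each argument serves both sides.
record Oriented (E : Fin m → Fin n → Bool)
                (_→₁_ : Fin m → Fin m → Set) (_→₂_ : Fin n → Fin n → Set) : Set where
  field
    asym₁ : ∀ {u v} → u →₁ v → ¬ (v →₁ u)
    asym₂ : ∀ {w z} → w →₂ z → ¬ (z →₂ w)
    push  : ∀ {u w v z} → Independent E u w v z → u →₁ v → w →₂ z
    pull  : ∀ {u w v z} → Independent E u w v z → w →₂ z → u →₁ v

oriented-flip : ∀ {E : Fin m → Fin n → Bool} {R Q} → Oriented E R Q → Oriented (flip E) Q R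
oriented-flip {E = E} O = record
  { asym₁ = asym₂ ; asym₂ = asym₁
  ; push = pull ∘ independent-flip (flip E) ; pull = push ∘ independent-flip (flip E) }
  where open Oriented O

Matched : (E : Fin m → Fin n → Bool) → (a b c : Fin m) (d p q : Fin n) → Set
Matched E a b c d p q =
  Edge E a d × ¬ Edge E b d × ¬ Edge E c d × ¬ Edge E a p × ¬ Edge E a q

Antipodal : (E : Fin m → Fin n → Bool) → (a b c : Fin m) (d p q : Fin n) → Set
Antipodal E a b c d p q =
  ¬ Edge E a d × Edge E b d × Edge E c d × Edge E a p × Edge E a q

-- Transport of cyclic triangles

-- A cyclic triangle whose arc b → c is parallel to p → q.  The six vertices a, b, c, d, p, q
-- induce a perfect matching 3K₂ or a six-cycle in which a and d are antipodal.
record Cyclic (E : Fin m → Fin n → Bool) (_→₁_ : Fin m → Fin m → Set)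
              (a b c : Fin m) (d p q : Fin n) : Set where
  constructor cyclic
  field
    arc   : Independent E b p c q
    a→b   : a →₁ b
    b→c   : b →₁ c
    c→a   : c →₁ a
    shape : Matched E a b c d p q ⊎ Antipodal E a b c d p q

module Transport {E : Fin m → Fin n → Bool} {_→₁_ _→₂_} (O : Oriented E _→₁_ _→₂_) where
  open Oriented O

  -- Each arc crosses over along two independent edges: two of `ad`, `bp`, `cq` in the matching, two
  -- opposite edges in the six-cycle a p b d c q. In the latter case c → a becomes d → p and a → b
  -- becomes q → d.
  cyclic-flip : ∀ {a b c d p q} → Cyclic E _→₁_ a b c d p q → Cyclic (flip E) _→₂_ d p q a b c
  cyclic-flip (cyclic bpcq@(bp , cq , _ , _ , ¬bq , ¬cp) a→b b→c c→a
                      (inj₁ (ad , ¬bd , ¬cd , ¬ap , ¬aq))) =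
    cyclic (independent-flip E bpcq)
           (push (independent E ad bp ¬ap ¬bd) a→b) (push bpcq b→c)
           (push (independent E cq ad ¬cd ¬aq) c→a)
           (inj₁ (ad , ¬ap , ¬aq , ¬bd , ¬cd))
  cyclic-flip (cyclic bpcq@(bp , cq , _ , _ , ¬bq , ¬cp) a→b b→c c→a
                      (inj₂ (¬ad , bd , cd , ap , aq))) =
    cyclic (independent-flip E bpcq)
           (push (independent E cd ap ¬cp ¬ad) c→a) (push bpcq b→c)
           (push (independent E aq bd ¬ad ¬bq) a→b)
           (inj₂ (¬ad , ap , aq , bd , cd))

  -- The new arcs are pulled back from the triangle `d`, `p`, `q`. The adjacencies of `b₂` and `c₂`
  -- to `d` must be those of `b` and `c`: otherwise some independent edges reverse an arc of that
  -- triangle.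
  slide : ∀ {a b c d p q b₂ c₂} → Cyclic E _→₁_ a b c d p q →
    Independent E b₂ p c₂ q → Cyclic E _→₁_ a b₂ c₂ d p q
  slide {a} {b} {c} {d} {p} {q} {b₂} {c₂}
        C@(cyclic bpcq@(bp , cq , _ , _ , ¬bq , ¬cp) a→b b→c c→a
                  (inj₁ (ad , ¬bd , ¬cd , ¬ap , ¬aq)))
        b₂pc₂q@(b₂p , c₂q , _ , _ , ¬b₂q , ¬c₂p) =
    cyclic b₂pc₂q (pull (independent E ad b₂p ¬ap ¬b₂d) d→p) (pull b₂pc₂q p→q)
           (pull (independent E c₂q ad ¬c₂d ¬aq) q→d)
           (inj₁ (ad , ¬b₂d , ¬c₂d , ¬ap , ¬aq))
    where
    open Cyclic (cyclic-flip C) renaming (a→b to d→p; b→c to p→q; c→a to q→d)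
    ¬b₂d : ¬ Edge E b₂ d
    ¬b₂d b₂d = asym₂ q→d
      (push (independent E b₂d cq ¬b₂q ¬cd) (pull (independent E b₂p cq ¬b₂q ¬cp) p→q))
    ¬c₂d : ¬ Edge E c₂ d
    ¬c₂d c₂d = asym₂ d→p
      (push (independent E bp c₂d ¬bd ¬c₂p) (pull (independent E bp c₂q ¬bq ¬c₂p) p→q))
  slide {a} {b} {c} {d} {p} {q} {b₂} {c₂}
        C@(cyclic bpcq@(bp , cq , _ , _ , ¬bq , ¬cp) a→b b→c c→a
                  (inj₂ (¬ad , bd , cd , ap , aq)))
        b₂pc₂q@(b₂p , c₂q , _ , _ , ¬b₂q , ¬c₂p) =
    cyclic b₂pc₂q (pull (independent E aq b₂d ¬ad ¬b₂q) q→d) (pull b₂pc₂q p→q)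
           (pull (independent E c₂d ap ¬c₂p ¬ad) d→p)
           (inj₂ (¬ad , b₂d , c₂d , ap , aq))
    where
    open Cyclic (cyclic-flip C) renaming (a→b to d→p; b→c to p→q; c→a to q→d)
    b₂d : Edge E b₂ d
    b₂d = decidable-stable (T? (E b₂ d)) λ ¬b₂d → asym₂ d→p
      (push (independent E b₂p cd ¬b₂d ¬cp) (pull (independent E b₂p cq ¬b₂q ¬cp) p→q))
    c₂d : Edge E c₂ d
    c₂d = decidable-stable (T? (E c₂ d)) λ ¬c₂d → asym₂ q→d
      (push (independent E bd c₂q ¬bq ¬c₂d) (pull (independent E bp c₂q ¬bq ¬c₂p) p→q))

  -- If `a` saw exactly one of `p`, `q`, then p → q would pull back to a → c or b → a. Otherwise `d`
  -- is a neighbour of `a` missed by `b` (matching) or of `b` missed by `a` (six-cycle); the wrong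
  -- adjacency of `c` to it would orient a pair in Y both ways.
  complete : ∀ {a b c p q} → a →₁ b → b →₁ c → c →₁ a → Excess E a b → Excess E b a →
    Independent E b p c q → ∃[ d ] Cyclic E _→₁_ a b c d p q
  complete {a} {b} {c} {p} {q} a→b b→c c→a (d , ad , ¬bd) (e , be , ¬ae)
           bpcq@(bp , cq , _ , _ , ¬bq , ¬cp) with T? (E a p) | T? (E a q)
  ... | yes ap | no ¬aq = ⊥-elim (asym₁ c→a
    (pull (independent E ap cq ¬aq ¬cp) (push bpcq b→c)))
  ... | no ¬ap | yes aq = ⊥-elim (asym₁ a→b
    (pull (independent E bp aq ¬bq ¬ap) (push bpcq b→c)))
  ... | no ¬ap | no ¬aq = d , cyclic bpcq a→b b→c c→a (inj₁ (ad , ¬bd , ¬cd , ¬ap , ¬aq))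
    where
    ¬cd : ¬ Edge E c d
    ¬cd cd = asym₂ (push (independent E ad bp ¬ap ¬bd) a→b)
                   (push (independent E bp cd ¬bd ¬cp) b→c)
  ... | yes ap | yes aq = e , cyclic bpcq a→b b→c c→a (inj₂ (¬ae , be , ce , ap , aq))
    where
    ce : Edge E c e
    ce = decidable-stable (T? (E c e)) λ ¬ce → asym₂
      (push (independent E aq be ¬ae ¬bq) a→b) (push (independent E be cq ¬bq ¬ce) b→c)

module _ {E : Fin m → Fin n → Bool} {_→₁_ _→₂_} (O : Oriented E _→₁_ _→₂_) where
  open Transport O
  private module Flipped = Transport (oriented-flip O)

  transport : ∀ {a b c d p q x y} → Cyclic E _→₁_ a b c d p q →
    Star (Parallel E) (pX b c) (pX x y) → (a →₁ x) × (x →₁ y) × (y →₁ a)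
  transport (cyclic _ a→b b→c c→a _) ε = a→b , b→c , c→a
  transport C (_◅_ {j = pX _ _} () _)
  transport C (_◅_ {j = pY p₂ q₂} _ (_◅_ {j = pY _ _} () _))
  -- Parallel steps alternate sides: the step into Y slides the flipped triangle, the step back into
  -- X slides the original one. Neither moves `a` or `d`.
  transport C (_◅_ {j = pY p₂ q₂} f (_◅_ {j = pX b₂ c₂} g π)) =
    transport
      (slide (Flipped.cyclic-flip (Flipped.slide (cyclic-flip C) (independent-flip E f))) g) π

-- Orders from an orientation of the classes

module Ordering (E : Fin m → Fin n → Bool) (σ : Fin m → Fin m → Set) where

  -- Vertices with comparable neighbourhoods are ordered by inclusion.
  data _≺_ (u v : Fin m) : Set where
    forced : Excess E u v → Excess E v u → σ u v → u ≺ v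
    below  : ¬ Excess E u v → Excess E v u → u ≺ v
    tied   : ¬ Excess E u v → ¬ Excess E v u → u Fin.< v → u ≺ v

  module _ (σ-asym : ∀ {u v} → u ≢ v → σ u v → ¬ σ v u) where

    ≺-asym : ∀ {u v} → u ≺ v → ¬ (v ≺ u)
    ≺-asym (forced uv vu s) (forced _ _ s')  = σ-asym (excess⇒≢ E uv) s s'
    ≺-asym (forced uv vu s) (below ¬vu _)    = ¬vu vu
    ≺-asym (forced uv vu s) (tied ¬vu _ _)   = ¬vu vu
    ≺-asym (below ¬uv vu)   (forced _ uv _)  = ¬uv uv
    ≺-asym (below ¬uv vu)   (below ¬vu _)    = ¬vu vu
    ≺-asym (below ¬uv vu)   (tied ¬vu _ _)   = ¬vu vu
    ≺-asym (tied ¬uv _ _)   (forced _ uv _)  = ¬uv uv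
    ≺-asym (tied ¬uv _ _)   (below _ uv)     = ¬uv uv
    ≺-asym (tied _ _ u<v)   (tied _ _ v<u)   = Fin.<-asym u<v v<u

    ≺-compare : (∀ {u v} → u ≢ v → σ u v ⊎ σ v u) → Trichotomous _≡_ _≺_
    ≺-compare σ-total u v with u Fin.≟ v
    ... | yes refl = tri≈ (λ u≺u → ≺-asym u≺u u≺u) refl (λ u≺u → ≺-asym u≺u u≺u)
    ... | no u≢v   = case-≢ linear
      where
      linear : u ≺ v ⊎ v ≺ u
      linear with excess? E u v | excess? E v u
      ... | no ¬uv | yes vu = inj₁ (below ¬uv vu)
      ... | yes uv | no ¬vu = inj₂ (below ¬vu uv)
      ... | yes uv | yes vu with σ-total u≢v
      ...   | inj₁ s = inj₁ (forced uv vu s)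
      ...   | inj₂ s = inj₂ (forced vu uv s)
      linear | no ¬uv | no ¬vu with Fin.<-cmp u v
      ...   | tri< u<v _ _ = inj₁ (tied ¬uv ¬vu u<v)
      ...   | tri≈ _ u≡v _ = ⊥-elim (u≢v u≡v)
      ...   | tri> _ _ v<u = inj₂ (tied ¬vu ¬uv v<u)
      case-≢ : u ≺ v ⊎ v ≺ u → Tri (u ≺ v) (u ≡ v) (v ≺ u)
      case-≢ (inj₁ u≺v) = tri< u≺v u≢v (≺-asym u≺v)
      case-≢ (inj₂ v≺u) = tri> (≺-asym v≺u) u≢v v≺u

    ≺-isStrictTotalOrder : (∀ {u v} → u ≢ v → σ u v ⊎ σ v u) →
      (∀ a b c → a ≺ b → b ≺ c → ¬ (c ≺ a)) → IsStrictTotalOrder _≡_ _≺_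
    ≺-isStrictTotalOrder σ-total acyclic = isStrictTotalOrderᶜ record
      { isEquivalence = isEquivalence ; trans = ≺-trans ; compare = ≺-compare σ-total }
      where
      ≺-trans : ∀ {a b c} → a ≺ b → b ≺ c → a ≺ c
      ≺-trans {a} {b} {c} a≺b b≺c with ≺-compare σ-total a c
      ... | tri< a≺c _ _ = a≺c
      ... | tri≈ _ refl _ = ⊥-elim (≺-asym a≺b b≺c)
      ... | tri> _ _ c≺a = ⊥-elim (acyclic a b c a≺b b≺c c≺a)

    module _ (σ-resp : ∀ {u v u' v' w z} → Independent E u w v z → Independent E u' w v' z →
                       σ u v → σ u' v') where

      -- Suppose N(a) ⊆ N(b). An inclusion on another arc composes to one refuting an excess
      -- recorded by some arc, unless all three arcs are ties, which order the indices cyclically.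
      -- There remains the case of two forced arcs.
      cyclic⇒excess : ∀ {a b c} → a ≺ b → b ≺ c → c ≺ a → Excess E a b
      cyclic⇒excess {a} {b} {c} a≺b b≺c c≺a = decidable-stable (excess? E a b) contra
        where
        contra : ¬ ¬ Excess E a b
        contra ¬ab = go a≺b b≺c c≺a
          where
          ⊆-trans : ∀ {u v w} → ¬ Excess E u v → ¬ Excess E v w → ¬ Excess E u w
          ⊆-trans ¬uv ¬vw (x , ux , ¬wx) = ¬wx (¬excess⇒⊆ E ¬vw (¬excess⇒⊆ E ¬uv ux))
          go : a ≺ b → b ≺ c → c ≺ a → ⊥
          go (forced ab _ _) _ _ = ¬ab ab
          go _ (below ¬bc _) (forced _ ac _) = ⊆-trans ¬ab ¬bc ac
          go _ (below ¬bc _) (below _ ac) = ⊆-trans ¬ab ¬bc ac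
          go _ (below ¬bc cb) (tied ¬ca _ _) = ⊆-trans ¬ca ¬ab cb
          go _ (tied ¬bc _ _) (forced _ ac _) = ⊆-trans ¬ab ¬bc ac
          go _ (tied ¬bc _ _) (below _ ac) = ⊆-trans ¬ab ¬bc ac
          go (below _ ba) (tied ¬bc _ _) (tied ¬ca _ _) = ⊆-trans ¬bc ¬ca ba
          go (tied _ _ a<b) (tied _ _ b<c) (tied _ _ c<a) =
            Fin.<-asym (Fin.<-trans a<b b<c) c<a
          go _ (forced _ cb _) (below ¬ca _) = ⊆-trans ¬ca ¬ab cb
          go _ (forced _ cb _) (tied ¬ca _ _) = ⊆-trans ¬ca ¬ab cb
          -- Both (c,a) and (c,b) are parallel to (p,q), so `σ` selects (c,b) along with (c,a),
          -- against b ≺ c.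
          go _ (forced bc (p , cp , ¬bp) s) (forced _ (q , aq , ¬cq) s') =
            σ-asym (excess⇒≢ E bc) s (σ-resp (independent E cp aq ¬cq ¬ap)
              (independent E cp (¬excess⇒⊆ E ¬ab aq) ¬cq ¬bp) s')
            where
            ¬ap : ¬ Edge E a p
            ¬ap ap = ¬bp (¬excess⇒⊆ E ¬ab ap)

      cyclic⇒excessʳ : ∀ {a b c} → a ≺ b → b ≺ c → c ≺ a → Excess E b a
      cyclic⇒excessʳ a≺b b≺c c≺a with a≺b
      ... | forced _ ba _  = ba
      ... | below _ ba     = ba
      ... | tied ¬ab _ _   = ⊥-elim (¬ab (cyclic⇒excess a≺b b≺c c≺a))

-- Exclusion of cyclic triangles.

record Selection (E : Fin m → Fin n → Bool)
                 (σ : Fin m → Fin m → Set) (τ : Fin n → Fin n → Set) : Set where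
  field
    σ-asym  : ∀ {u v} → u ≢ v → σ u v → ¬ σ v u
    σ-total : ∀ {u v} → u ≢ v → σ u v ⊎ σ v u
    τ-asym  : ∀ {w z} → w ≢ z → τ w z → ¬ τ z w
    τ-total : ∀ {w z} → w ≢ z → τ w z ⊎ τ z w
    push    : ∀ {u w v z} → Independent E u w v z → σ u v → τ w z
    pull    : ∀ {u w v z} → Independent E u w v z → τ w z → σ u v
    -- The bound is by the second entry because `acyclicX` applies it to the arc (c,a) and inducts
    -- on `a`.
    leader  : ∀ {u v} → u ≢ v → σ u v →
              ∃[ x ] ∃[ y ] (x Fin.≤ v × Star (Parallel E) (pX u v) (pX x y))

module _ {E : Fin m → Fin n → Bool} {σ τ} (sel : Selection E σ τ) where
  open Selection sel
  private
    module X = Ordering E σ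
    module Y = Ordering (flip E) τ
  open X using () renaming (_≺_ to _≺X_; forced to forcedX; below to belowX; tied to tiedX)
  open Y using () renaming (_≺_ to _≺Y_; forced to forcedY; below to belowY; tied to tiedY)

  -- Independent edges give excess both ways, so on their ends only `forced` is possible and `σ`,
  -- `τ` decide.
  oriented : Oriented E _≺X_ _≺Y_
  oriented = record
    { asym₁ = X.≺-asym σ-asym
    ; asym₂ = Y.≺-asym τ-asym
    ; push = pushed
    ; pull = pulled
    }
    where
    pushed : ∀ {u w v z} → Independent E u w v z → u ≺X v → w ≺Y z
    pushed i (forcedX _ _ s) =
      let wz , zw = independent⇒excess (flip E) (independent-flip E i) in forcedY wz zw (push i s)
    pushed i (belowX ¬uv _)  = ⊥-elim (¬uv (proj₁ (independent⇒excess E i)))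
    pushed i (tiedX ¬uv _ _) = ⊥-elim (¬uv (proj₁ (independent⇒excess E i)))
    pulled : ∀ {u w v z} → Independent E u w v z → w ≺Y z → u ≺X v
    pulled i (forcedY _ _ s) =
      let uv , vu = independent⇒excess E i in forcedX uv vu (pull i s)
    pulled i (belowY ¬wz _)  =
      ⊥-elim (¬wz (proj₁ (independent⇒excess (flip E) (independent-flip E i))))
    pulled i (tiedY ¬wz _ _) =
      ⊥-elim (¬wz (proj₁ (independent⇒excess (flip E) (independent-flip E i))))

  private
    respX : ∀ {u v u' v' w z} → Independent E u w v z → Independent E u' w v' z → σ u v → σ u' v'
    respX i j = pull j ∘ push i
    respY : ∀ {u v u' v' w z} → Independent (flip E) u w v z → Independent (flip E) u' w v' z →
            τ u v → τ u' v'
    respY i j = push (independent-flip (flip E) j) ∘ pull (independent-flip (flip E) i)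

  -- Induction on `a` plays the part of minimality. The triangle is read as b → c → a → b: `b` stays
  -- fixed while (c,a) moves to its representative (x,y), and x < a gives the smaller triangle x → y
  -- → b → x.
  acyclicX : ∀ a b c → a ≺X b → b ≺X c → ¬ (c ≺X a)
  acyclicX a = go a (<-wellFounded (toℕ a))
    where
    go : ∀ a → Acc ℕ._<_ (toℕ a) → ∀ b c → a ≺X b → b ≺X c → ¬ (c ≺X a)
    go a (acc rs) b c a≺b b≺c c≺a
      with X.cyclic⇒excess σ-asym respX b≺c c≺a a≺b
         | X.cyclic⇒excessʳ σ-asym respX b≺c c≺a a≺b
         | X.cyclic⇒excess σ-asym respX c≺a a≺b b≺c | c≺a
    ... | _ | _ | ca | belowX ¬ca _ = ¬ca ca
    ... | _ | _ | ca | tiedX ¬ca _ _ = ¬ca ca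
    ... | bc | cb | _ | forcedX ca@(p , cp , ¬ap) (q , aq , ¬cq) s
      with leader (excess⇒≢ E ca) s
         | Transport.complete oriented b≺c c≺a a≺b bc cb (independent E cp aq ¬cq ¬ap)
    ... | x , y , x≤a , π | d , C
      with transport oriented C π | x Fin.≟ a
    ... | b≺x , x≺y , y≺b | yes refl = X.≺-asym σ-asym a≺b b≺x
    ... | b≺x , x≺y , y≺b | no x≢a = go x (rs (Fin.≤∧≢⇒< x≤a x≢a)) y b x≺y y≺b b≺x

  -- The triangle completes to a `Cyclic` configuration, whose flip is a cyclic triangle in X.
  acyclicY : ∀ a b c → a ≺Y b → b ≺Y c → ¬ (c ≺Y a)
  acyclicY a b c a≺b b≺c c≺a
    with Y.cyclic⇒excess τ-asym respY b≺c c≺a a≺b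
       | Y.cyclic⇒excessʳ τ-asym respY b≺c c≺a a≺b
  ... | p , bp , ¬cp | q , cq , ¬bq
    with Transport.complete (oriented-flip oriented) a≺b b≺c c≺a
           (Y.cyclic⇒excess τ-asym respY a≺b b≺c c≺a)
           (Y.cyclic⇒excessʳ τ-asym respY a≺b b≺c c≺a)
           (independent (flip E) bp cq ¬bq ¬cp)
  ... | d , C with Transport.cyclic-flip (oriented-flip oriented) C
  ... | cyclic _ d≺p p≺q q≺d _ = acyclicX d p q d≺p p≺q q≺d

  selection⇒cocomparability : CocomparabilityBigraph E
  selection⇒cocomparability =
    _≺X_ , _≺Y_ ,
    X.≺-isStrictTotalOrder σ-asym σ-total acyclicX ,
    Y.≺-isStrictTotalOrder τ-asym τ-total acyclicY ,
    uncrossed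
    where
    uncrossed : ∀ u v w z → u ≺X v → w ≺Y z → Edge E u z → Edge E v w → Edge E u w ⊎ Edge E v z
    uncrossed u v w z u≺v w≺z uz vw with T? (E u w) | T? (E v z)
    ... | yes uw | _      = inj₁ uw
    ... | no _   | yes vz = inj₂ vz
    ... | no ¬uw | no ¬vz = ⊥-elim (Oriented.asym₂ oriented w≺z
      (Oriented.push oriented (independent E uz vw ¬uw ¬vz) u≺v))

-- Representatives of the components of G⁺

-- Union-find: each edge merges the classes of its ends, and the leader of smaller rank survives. If
-- the edges generate `_≈_`, leaders are constant on classes, so the rank bound makes each one
-- minimal in its class.
join-edges : {A : Set} (_≟_ : DecidableEquality A) (rank : A → ℕ) {_≈_ : A → A → Set} →
  IsEquivalence _≈_ → (es : List (A × A)) → All (λ (a , b) → a ≈ b) es →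
  Σ (A → A) λ ℓ → (∀ p → p ≈ ℓ p) × (∀ p → rank (ℓ p) ℕ.≤ rank p) ×
                  All (λ (a , b) → ℓ a ≡ ℓ b) es
join-edges _≟_ rank eqv [] [] =
  (λ p → p) , (λ p → IsEquivalence.refl eqv) , (λ p → ℕ.≤-refl) , []
join-edges {A} _≟_ rank {_≈_} eqv ((a , b) ∷ es) (a≈b ∷ es≈)
  with join-edges _≟_ rank eqv es es≈
... | ℓ , sound , small , joined = case-≤ (ℕ.≤-total (rank (ℓ a)) (rank (ℓ b)))
  where
  open IsEquivalence eqv using () renaming (sym to ≈-sym; trans to ≈-trans; refl to ≈-refl)
  ℓa≈ℓb : ℓ a ≈ ℓ b
  ℓa≈ℓb = ≈-trans (≈-sym (sound a)) (≈-trans a≈b (sound b))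

  module Merge (r s : A) (r≈s : r ≈ s) (r≤s : rank r ℕ.≤ rank s) where
    merge : A → A
    merge q with q ≟ s
    ... | yes _ = r
    ... | no _  = q
    merge-≈ : ∀ q → q ≈ merge q
    merge-≈ q with q ≟ s
    ... | yes refl = ≈-sym r≈s
    ... | no _     = ≈-refl
    merge-≤ : ∀ q → rank (merge q) ℕ.≤ rank q
    merge-≤ q with q ≟ s
    ... | yes refl = r≤s
    ... | no _     = ℕ.≤-refl
    merge-s : merge s ≡ r
    merge-s with s ≟ s
    ... | yes _  = refl
    ... | no s≢s = ⊥-elim (s≢s refl)
    merge-r : merge r ≡ r
    merge-r with r ≟ s
    ... | yes _ = refl
    ... | no _  = refl
    result : merge (ℓ a) ≡ merge (ℓ b) → _
    result eq = merge ∘ ℓ , (λ p → ≈-trans (sound p) (merge-≈ (ℓ p))) ,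
      (λ p → ℕ.≤-trans (merge-≤ (ℓ p)) (small p)) , eq ∷ All.map (cong merge) joined

  case-≤ : rank (ℓ a) ℕ.≤ rank (ℓ b) ⊎ rank (ℓ b) ℕ.≤ rank (ℓ a) →
    Σ (A → A) λ ℓ → (∀ p → p ≈ ℓ p) × (∀ p → rank (ℓ p) ℕ.≤ rank p) ×
                    All (λ (a , b) → ℓ a ≡ ℓ b) ((a , b) ∷ es)
  case-≤ (inj₁ a≤b) = result (trans merge-r (sym merge-s))
    where open Merge (ℓ a) (ℓ b) ℓa≈ℓb a≤b
  case-≤ (inj₂ b≤a) = result (trans merge-s (sym merge-r))
    where open Merge (ℓ b) (ℓ a) (≈-sym ℓa≈ℓb) b≤a

module _ (E : Fin m → Fin n → Bool) where

  swap-involutive : ∀ p → swap E (swap E p) ≡ p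
  swap-involutive (pX u v) = refl
  swap-involutive (pY u v) = refl

  pair-≟ : DecidableEquality (Pair E)
  pair-≟ (pX u v) (pX u' v') with u Fin.≟ u' | v Fin.≟ v'
  ... | yes refl | yes refl = yes refl
  ... | no u≢u'  | _        = no λ { refl → u≢u' refl }
  ... | _        | no v≢v'  = no λ { refl → v≢v' refl }
  pair-≟ (pY u v) (pY u' v') with u Fin.≟ u' | v Fin.≟ v'
  ... | yes refl | yes refl = yes refl
  ... | no u≢u'  | _        = no λ { refl → u≢u' refl }
  ... | _        | no v≢v'  = no λ { refl → v≢v' refl }
  pair-≟ (pX _ _) (pY _ _) = no λ ()
  pair-≟ (pY _ _) (pX _ _) = no λ ()

  independent? : ∀ x y x' y' → Dec (Independent E x y x' y')
  independent? x y x' y' = T? (E x y) ×-dec T? (E x' y') ×-dec ¬? (x Fin.≟ x') ×-dec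
    ¬? (y Fin.≟ y') ×-dec ¬? (T? (E x y')) ×-dec ¬? (T? (E x' y))

  parallel? : ∀ p q → Dec (Parallel E p q)
  parallel? (pX u v) (pX _ _) = no λ ()
  parallel? (pX u v) (pY w z) = independent? u w v z
  parallel? (pY w z) (pX u v) = independent? u w v z
  parallel? (pY w z) (pY _ _) = no λ ()

  parallel-sym : ∀ {p q} → Parallel E p q → Parallel E q p
  parallel-sym {pX _ _} {pY _ _} i = i
  parallel-sym {pY _ _} {pX _ _} i = i

  parallel-swap : ∀ {p q} → Parallel E p q → Parallel E (swap E p) (swap E q)
  parallel-swap {pX _ _} {pY _ _} = independent-sym E
  parallel-swap {pY _ _} {pX _ _} = independent-sym E

  parallel⇒inF : ∀ {p q} → Parallel E p q → InF E p
  parallel⇒inF {pX _ _} {pY _ _} (_ , _ , u≢v , _) = u≢v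
  parallel⇒inF {pY _ _} {pX _ _} (_ , _ , _ , w≢z , _) = w≢z

  inF-swap : ∀ {p} → InF E p → InF E (swap E p)
  inF-swap {pX _ _} u≢v = u≢v ∘ sym
  inF-swap {pY _ _} u≢v = u≢v ∘ sym

  pairs : List (Pair E)
  pairs =
    cartesianProductWith pX (allFin m) (allFin m) ++ cartesianProductWith pY (allFin n) (allFin n)

  ∈-pairs : ∀ p → p ∈ pairs
  ∈-pairs (pX u v) = ∈-++⁺ˡ (∈-cartesianProductWith⁺ pX (∈-allFin u) (∈-allFin v))
  ∈-pairs (pY u v) = ∈-++⁺ʳ (cartesianProductWith pX (allFin m) (allFin m))
    (∈-cartesianProductWith⁺ pY (∈-allFin u) (∈-allFin v))

  _⇉_ : Pair E → Pair E → Set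
  _⇉_ = Star (Parallel E)

  ⇉-swap : ∀ {p q} → p ⇉ q → swap E p ⇉ swap E q
  ⇉-swap = gmap (swap E) parallel-swap

  ⇉-swapˡ : ∀ {p q} → swap E p ⇉ q → p ⇉ swap E q
  ⇉-swapˡ {p} π = subst (_⇉ _) (swap-involutive p) (⇉-swap π)

  ⇉-sym : ∀ {p q} → p ⇉ q → q ⇉ p
  ⇉-sym = reverse parallel-sym

  -- On 𝓕 the classes are the components of G⁺: a class of parallel pairs together with its
  -- reversal.
  _≈_ : Pair E → Pair E → Set
  p ≈ q = p ⇉ q ⊎ swap E p ⇉ q

  ≈-isEquivalence : IsEquivalence _≈_
  ≈-isEquivalence = record { refl = inj₁ ε ; sym = ≈-sym ; trans = ≈-trans }
    where
    ≈-sym : ∀ {p q} → p ≈ q → q ≈ p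
    ≈-sym (inj₁ π) = inj₁ (⇉-sym π)
    ≈-sym (inj₂ π) = inj₂ (⇉-sym (⇉-swapˡ π))
    ≈-trans : ∀ {p q r} → p ≈ q → q ≈ r → p ≈ r
    ≈-trans (inj₁ π) (inj₁ ρ) = inj₁ (π ◅◅ ρ)
    ≈-trans (inj₁ π) (inj₂ ρ) = inj₂ (⇉-swap π ◅◅ ρ)
    ≈-trans (inj₂ π) (inj₁ ρ) = inj₂ (π ◅◅ ρ)
    ≈-trans (inj₂ π) (inj₂ ρ) = inj₁ (⇉-swapˡ π ◅◅ ρ)

  -- Pairs in Y rank above all pairs in X, so a class meeting X has its representative in X.
  rank : Pair E → ℕ
  rank (pX u v) = toℕ u
  rank (pY _ _) = m

  record Representatives : Set where
    field
      rep          : Pair E → Pair E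
      rep-≈        : ∀ p → p ≈ rep p
      rep-≤        : ∀ p → rank (rep p) ℕ.≤ rank p
      rep-swap     : ∀ p → rep p ≡ rep (swap E p)
      rep-parallel : ∀ {p q} → Parallel E p q → rep p ≡ rep q

  representatives : Representatives
  representatives = record
    { rep = rep ; rep-≈ = sound ; rep-≤ = small
    ; rep-swap = λ p → All.lookup joined
        (∈-filter⁺ linked? (∈-cartesianProduct⁺ (∈-pairs p) (∈-pairs _)) (inj₁ refl))
    ; rep-parallel = λ {p} {q} i → All.lookup joined
        (∈-filter⁺ linked? (∈-cartesianProduct⁺ (∈-pairs p) (∈-pairs q)) (inj₂ i))
    }
    where
    Linked : Pair E × Pair E → Set
    Linked (p , q) = q ≡ swap E p ⊎ Parallel E p q
    linked? : ∀ e → Dec (Linked e)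
    linked? (p , q) = pair-≟ q (swap E p) ⊎-dec parallel? p q
    linked⇒≈ : ∀ {e} → Linked e → proj₁ e ≈ proj₂ e
    linked⇒≈ (inj₁ refl) = inj₂ ε
    linked⇒≈ (inj₂ i)    = inj₁ (i ◅ ε)
    es : List (Pair E × Pair E)
    es = filter linked? (cartesianProduct pairs pairs)
    folded = join-edges pair-≟ rank ≈-isEquivalence es
      (All.map linked⇒≈ (all-filter linked? (cartesianProduct pairs pairs)))
    rep = proj₁ folded
    sound = proj₁ (proj₂ folded)
    small = proj₁ (proj₂ (proj₂ folded))
    joined = proj₂ (proj₂ (proj₂ folded))

  -- The selection made by a 2-colouring.

  module _ (c : Pair E → Bool) (proper : ∀ a b → Adj⁺ E a b → c a ≢ c b) where
    open Representatives representatives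

    c-swap : ∀ {p} → InF E p → c (swap E p) ≢ c p
    c-swap {p} p∈F = proper p (swap E p) (inj₁ (p∈F , inF-swap p∈F , refl)) ∘ sym

    ≢-≢⇒≡ : ∀ {x y z : Bool} → x ≢ y → z ≢ y → x ≡ z
    ≢-≢⇒≡ x≢y z≢y = trans (¬-not x≢y) (sym (¬-not z≢y))

    c-parallel : ∀ {p q} → Parallel E p q → c p ≡ c q
    c-parallel {p} {q} i = ≢-≢⇒≡
      (proper p (swap E q) (inj₂ (parallel⇒inF i , inF-swap q∈F , i))) (c-swap q∈F ∘ sym)
      where q∈F = parallel⇒inF (parallel-sym i)

    c-⇉ : ∀ {p q} → p ⇉ q → c p ≡ c q
    c-⇉ ε       = refl
    c-⇉ (i ◅ π) = trans (c-parallel i) (c-⇉ π)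

    -- c is flipped on some components of G⁺ so that all representatives are selected.
    Selected : Pair E → Set
    Selected p = c p ≡ c (rep p)

    selected-asym : ∀ {p} → InF E p → Selected p → ¬ Selected (swap E p)
    selected-asym {p} p∈F s s' =
      c-swap p∈F (trans s' (trans (cong c (sym (rep-swap p))) (sym s)))

    selected-total : ∀ {p} → InF E p → Selected p ⊎ Selected (swap E p)
    selected-total {p} p∈F with c p Bool.≟ c (rep p)
    ... | yes s = inj₁ s
    ... | no ¬s = inj₂ (trans (≢-≢⇒≡ (c-swap p∈F) (¬s ∘ sym)) (cong c (rep-swap p)))

    selected-parallel : ∀ {p q} → Parallel E p q → Selected p → Selected q
    selected-parallel i s =
      trans (sym (c-parallel i)) (trans s (cong c (rep-parallel i)))

    -- `c` is constant along parallel paths, so a path from the reversal of `p` would give `p` and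
    -- its reversal the same colour.
    selected⇉rep : ∀ {p} → InF E p → Selected p → p ⇉ rep p
    selected⇉rep {p} p∈F s with rep-≈ p
    ... | inj₁ π = π
    ... | inj₂ π = ⊥-elim (c-swap p∈F (trans (c-⇉ π) (sym s)))

    -- The representative is shared with (v,u), which has rank `v`; this is below `m`, the rank of
    -- pairs in Y.
    leader : ∀ {u v} → u ≢ v → Selected (pX u v) →
      ∃[ x ] ∃[ y ] (x Fin.≤ v × pX u v ⇉ pX x y)
    leader {u} {v} u≢v s with rep (pX u v) | selected⇉rep u≢v s
                            | subst (λ r → rank r ℕ.≤ toℕ v) (sym (rep-swap (pX u v))) (rep-≤ (pX v u))
    ... | pX x y | π | x≤v = x , y , x≤v , π
    ... | pY _ _ | _ | m≤v = ⊥-elim (ℕ.<⇒≱ (Fin.toℕ<n v) m≤v)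

    selection : Selection E (λ u v → Selected (pX u v)) (λ w z → Selected (pY w z))
    selection = record
      { σ-asym = λ {u} {v} → selected-asym {pX u v} ; σ-total = λ {u} {v} → selected-total {pX u v}
      ; τ-asym = λ {w} {z} → selected-asym {pY w z} ; τ-total = λ {w} {z} → selected-total {pY w z}
      ; push = λ {u} {w} {v} {z} → selected-parallel {pX u v} {pY w z}
      ; pull = λ {u} {w} {v} {z} → selected-parallel {pY w z} {pX u v}
      ; leader = leader }

bipartite⁺⇒cocomparability : (E : Fin m → Fin n → Bool) → Bipartite⁺ E → CocomparabilityBigraph E
bipartite⁺⇒cocomparability E (c , proper) = selection⇒cocomparability (selection E c proper)

-- From linear orderings to a 2-colouring.

does-≢ : ∀ {P Q : Set} (P? : Dec P) (Q? : Dec Q) → (P → ¬ Q) → (¬ P → ¬ ¬ Q) → does P? ≢ does Q?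
does-≢ (yes p) (yes q) ¬pq _ refl = ¬pq p q
does-≢ (no ¬p) (no ¬q) _ pq refl = pq ¬p ¬q

-- Pairs are coloured by whether they increase. For independent `uw` and `vz`, equal colours of
-- (u,v) and (z,w) would make these edges cross with neither `uz` nor `vw` present.
cocomparability⇒bipartite⁺ : (E : Fin m → Fin n → Bool) → CocomparabilityBigraph E → Bipartite⁺ E
cocomparability⇒bipartite⁺ E (_≺X_ , _≺Y_ , stoX , stoY , uncrossed) = colour , proper
  where
  module X = IsStrictTotalOrder stoX
  module Y = IsStrictTotalOrder stoY

  colour : Pair E → Bool
  colour (pX u v) = does (u X.<? v)
  colour (pY w z) = does (w Y.<? z)

  swapX : ∀ {u v} → u ≢ v → ¬ (u ≺X v) → v ≺X u
  swapX {u} {v} u≢v u⊀v with X.compare u v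
  ... | tri< u≺v _ _ = ⊥-elim (u⊀v u≺v)
  ... | tri≈ _ u≡v _ = ⊥-elim (u≢v u≡v)
  ... | tri> _ _ v≺u = v≺u

  swapY : ∀ {w z} → w ≢ z → ¬ (w ≺Y z) → z ≺Y w
  swapY {w} {z} w≢z w⊀z with Y.compare w z
  ... | tri< w≺z _ _ = ⊥-elim (w⊀z w≺z)
  ... | tri≈ _ w≡z _ = ⊥-elim (w≢z w≡z)
  ... | tri> _ _ z≺w = z≺w

  ¬crossed : ∀ {u w v z} → Independent E u w v z → u ≺X v → ¬ (z ≺Y w)
  ¬crossed {u} {w} {v} {z} (uw , vz , _ , _ , ¬uz , ¬vw) u≺v z≺w
    with uncrossed u v z w u≺v z≺w uw vz
  ... | inj₁ uz = ¬uz uz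
  ... | inj₂ vw = ¬vw vw

  ¬¬crossed : ∀ {u w v z} → Independent E u w v z → ¬ (u ≺X v) → ¬ ¬ (z ≺Y w)
  ¬¬crossed i@(_ , _ , u≢v , w≢z , _) u⊀v z⊀w =
    ¬crossed (independent-sym E i) (swapX u≢v u⊀v) (swapY (w≢z ∘ sym) z⊀w)

  proper : ∀ a b → Adj⁺ E a b → colour a ≢ colour b
  proper (pX u v) _ (inj₁ (u≢v , _ , refl)) =
    does-≢ (u X.<? v) (v X.<? u) X.asym (λ u⊀v v⊀u → v⊀u (swapX u≢v u⊀v))
  proper (pY w z) _ (inj₁ (w≢z , _ , refl)) =
    does-≢ (w Y.<? z) (z Y.<? w) Y.asym (λ w⊀z z⊀w → z⊀w (swapY w≢z w⊀z))
  proper (pX u v) (pY z w) (inj₂ (_ , _ , i)) =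
    does-≢ (u X.<? v) (z Y.<? w) (¬crossed i) (¬¬crossed i)
  proper (pY w z) (pX v u) (inj₂ (_ , _ , i)) =
    does-≢ (w Y.<? z) (v X.<? u) (λ w≺z v≺u → ¬crossed (independent-sym E i) v≺u w≺z)
           (λ w⊀z v⊀u → ¬¬crossed (independent-sym E i) v⊀u w⊀z)

-- Weak edge-asteroids from odd cycles

module _ (E : Fin m → Fin n → Bool) where

  -- The second entry is `first` of the reversal. Parallel `p`, `q` thus encode two independent
  -- edges, one joining their first entries and one those of their reversals.
  first : Pair E → VG E
  first (pX u v) = inj₁ u
  first (pY w z) = inj₂ w

  edge : ∀ {p q} → Parallel E p q → EdgeOf E
  edge {pX u v} {pY w z} (uw , _) = (u , w) , uw
  edge {pY w z} {pX u v} (uw , _) = (u , w) , uw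

  edge-covered : ∀ {p q ws} (i : Parallel E p q) →
    first p ∈ ws → first q ∈ ws → Covers E ws (edge i)
  edge-covered {pX _ _} {pY _ _} i p∈ q∈ = p∈ , q∈
  edge-covered {pY _ _} {pX _ _} i p∈ q∈ = q∈ , p∈

  edge-avoided : ∀ {p q ws} (i : Parallel E p q) →
    All (λ v → ¬ AdjG E v (first p) × ¬ AdjG E v (first q)) ws → Avoids E ws (edge i)
  edge-avoided {pX _ _} {pY _ _} i avoid v v∈ = All.lookup avoid v∈
  edge-avoided {pY _ _} {pX _ _} i avoid v v∈ = swap× (All.lookup avoid v∈)

  parallel⇒adjacent : ∀ {p q} → Parallel E p q → AdjG E (first p) (first q)
  parallel⇒adjacent {pX _ _} {pY _ _} (uw , _) = uw
  parallel⇒adjacent {pY _ _} {pX _ _} (uw , _) = uw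

  ¬adjacent-swap : ∀ p → ¬ AdjG E (first (swap E p)) (first p)
  ¬adjacent-swap (pX _ _) ()
  ¬adjacent-swap (pY _ _) ()

  ¬adjacent-next : ∀ {p q} → Parallel E p q → ¬ AdjG E (first (swap E p)) (first q)
  ¬adjacent-next {pX _ _} {pY _ _} (_ , _ , _ , _ , _ , ¬vw) = ¬vw
  ¬adjacent-next {pY _ _} {pX _ _} (_ , _ , _ , _ , ¬uz , _) = ¬uz

  ¬adjacent-previous : ∀ {p q} → Parallel E p q → ¬ AdjG E (first (swap E q)) (first p)
  ¬adjacent-previous i = ¬adjacent-next (parallel-sym E i)

  ¬adjacent-skip : ∀ {p q r} → Parallel E p q → Parallel E q r →
    ¬ AdjG E (first (swap E p)) (first r) × ¬ AdjG E (first (swap E r)) (first p)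
  ¬adjacent-skip {pX _ _} {pY _ _} {pX _ _} _ _ = (λ ()) , (λ ())
  ¬adjacent-skip {pY _ _} {pX _ _} {pY _ _} _ _ = (λ ()) , (λ ())

  ¬parallel-swap : ∀ p → ¬ Parallel E p (swap E p)
  ¬parallel-swap (pX _ _) ()
  ¬parallel-swap (pY _ _) ()

  private
    _⟶_ : Pair E → Pair E → Set
    _⟶_ = _⇉_ E

  -- Here r = k + 1: gₜ joins the first entries of `at t` and `at (suc t)`, and gₜ₊ᵣ joins their
  -- second entries. Indexing by ℕ postpones reduction of indices.
  record AntiperiodicWalk : Set where
    field
      k            : ℕ
      k≥1          : 1 ℕ.≤ k
      at           : ℕ → Pair E
      parallel     : ∀ t → Parallel E (at t) (at (suc t))
      antiperiodic : ∀ t → at (t + suc k) ≡ swap E (at t)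

  antiperiodic⇒asteroid : AntiperiodicWalk → WeakEdgeAsteroid E
  antiperiodic⇒asteroid W = record
    { k = k ; k≥1 = k≥1 ; e = e
    ; walk = λ i → ws (toℕ i) , isWalk (toℕ i) , covers-k i , covers-suc-k i , avoids i }
    where
    open AntiperiodicWalk W

    e : Fin (suc (k + k)) → EdgeOf E
    -- The shift by one omits g₀: the closed walk has 2k + 2 edges, the asteroid 2k + 1.
    e i = edge (parallel (suc (toℕ i)))

    ws : ℕ → List (VG E)
    -- The antipode of `e i` with its two neighbouring edges in the closed walk. Three edges are
    -- taken because for i = k the edges `e (i ⊕ k)` and `e (i ⊕ suc k)` lie on either side of the
    -- omitted g₀.
    ws t = List.map (λ j → first (swap E (at (j + t)))) (0 ∷ 1 ∷ 2 ∷ 3 ∷ [])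

    isWalk : ∀ t → IsWalk E (ws t)
    isWalk t = step (adj t) (step (adj (1 + t)) (step (adj (2 + t)) (single _)))
      where
      adj : ∀ t → AdjG E (first (swap E (at t))) (first (swap E (at (suc t))))
      adj t = parallel⇒adjacent (parallel-swap E (parallel t))

    avoids : ∀ i → Avoids E (ws (toℕ i)) (e i)
    -- The middle edge is independent of `e i`. Each outer vertex is on the same side as one end of
    -- `e i` and misses the other because a neighbouring edge of the closed walk is independent of
    -- its antipode.
    avoids i = edge-avoided (parallel (suc t))
      ( (¬adjacent-next (parallel t) , proj₁ (¬adjacent-skip (parallel t) (parallel (1 + t))))
      ∷ (¬adjacent-swap (at (1 + t)) , ¬adjacent-next (parallel (1 + t)))
      ∷ (¬adjacent-previous (parallel (1 + t)) , ¬adjacent-swap (at (2 + t)))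
      ∷ (proj₂ (¬adjacent-skip (parallel (1 + t)) (parallel (2 + t))) ,
         ¬adjacent-previous (parallel (2 + t)))
      ∷ [] )
      where t = toℕ i

    periodic : ∀ t → at (t + suc k + suc k) ≡ at t
    periodic t = trans (antiperiodic (t + suc k))
      (trans (cong (swap E) (antiperiodic t)) (swap-involutive E (at t)))

    N : ℕ
    N = suc (k + k)

    unwrap : ∀ t → t ℕ.< N + N → t ≡ t % N ⊎ t ≡ t % N + N
    unwrap t t<2N with t ℕ.<? N
    ... | yes t<N = inj₁ (sym (m<n⇒m%n≡m t<N))
    ... | no t≮N  = inj₂ (trans (sym (ℕ.m∸n+n≡m N≤t)) (cong (_+ N)
        (trans (sym (m<n⇒m%n≡m t∸N<N)) (m≤n⇒[n∸m]%m≡n%m N≤t))))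
      where
      N≤t = ℕ.≮⇒≥ t≮N
      t∸N<N : t ℕ.∸ N ℕ.< N
      t∸N<N = ℕ.+-cancelʳ-< N (t ℕ.∸ N) N (subst (ℕ._< N + N) (sym (ℕ.m∸n+n≡m N≤t)) t<2N)

    ⊕-unwrap : ∀ (i : Fin N) j → j ℕ.≤ N →
      toℕ i + j ≡ toℕ (i ⊕ j) ⊎ toℕ i + j ≡ toℕ (i ⊕ j) + N
    ⊕-unwrap i j j≤N = subst (λ x → toℕ i + j ≡ x ⊎ toℕ i + j ≡ x + N)
      (sym (Fin.toℕ-fromℕ< _)) (unwrap (toℕ i + j) (ℕ.+-mono-<-≤ (Fin.toℕ<n i) j≤N))

    -- Since 2 (k + 1) = N + 1, wrapping around mod N shifts by one along the walk.
    at-unwrap : ∀ s i x → suc i + k ≡ x → at (s + x) ≡ swap E (at (s + i))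
    at-unwrap s i x refl =
      trans (cong at (solve 3 (λ s i k → s :+ (con 1 :+ i :+ k) := s :+ i :+ (con 1 :+ k)) refl s i k))
            (antiperiodic (s + i))

    at-wrap : ∀ s i x → i + k ≡ x + N → at (s + suc x) ≡ swap E (at (s + suc i))
    at-wrap s i x eq = trans (sym (periodic (s + suc x))) (trans (cong at lemma) (antiperiodic _))
      where
      lemma : s + suc x + suc k + suc k ≡ s + suc i + suc k
      lemma = trans
        (solve 3 (λ s x k → s :+ (con 1 :+ x) :+ (con 1 :+ k) :+ (con 1 :+ k) :=
          s :+ (con 2 :+ (x :+ (con 1 :+ (k :+ k))))) refl s x k)
        (trans (cong (λ y → s + suc (suc y)) (sym eq))
          (solve 3 (λ s i k → s :+ (con 2 :+ (i :+ k)) := s :+ (con 1 :+ i) :+ (con 1 :+ k))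
            refl s i k))

    -- `t` is the place of the edge in the window: 0 for `e (i ⊕ k)` and 1 for `e (i ⊕ suc k)`, each
    -- one more after wrapping around.
    covers : ∀ i j t → t ∈ (0 ∷ 1 ∷ 2 ∷ []) →
      at (suc (toℕ j)) ≡ swap E (at (t + i)) →
      at (suc (suc (toℕ j))) ≡ swap E (at (suc t + i)) → Covers E (ws i) (e j)
    covers i j t t∈ eq eq' = edge-covered (parallel (suc (toℕ j)))
      (subst (_∈ ws i) (sym (cong first eq)) (∈-map⁺ vertex (early t∈)))
      (subst (_∈ ws i) (sym (cong first eq')) (∈-map⁺ vertex (late t∈)))
      where
      vertex : ℕ → VG E
      vertex j = first (swap E (at (j + i)))
      early : ∀ {t} → t ∈ (0 ∷ 1 ∷ 2 ∷ []) → t ∈ (0 ∷ 1 ∷ 2 ∷ 3 ∷ [])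
      early t∈ = ∈-++⁺ˡ t∈
      late : ∀ {t} → t ∈ (0 ∷ 1 ∷ 2 ∷ []) → suc t ∈ (0 ∷ 1 ∷ 2 ∷ 3 ∷ [])
      late t∈ = there (∈-map⁺ suc t∈)

    covers-k : ∀ i → Covers E (ws (toℕ i)) (e (i ⊕ k))
    covers-k i with ⊕-unwrap i k (ℕ.≤-trans (ℕ.m≤m+n k k) (ℕ.n≤1+n _))
    ... | inj₁ eq = covers (toℕ i) (i ⊕ k) 0 (here refl)
      (at-unwrap 0 (toℕ i) _ (cong suc eq)) (at-unwrap 1 (toℕ i) _ (cong suc eq))
    ... | inj₂ eq = covers (toℕ i) (i ⊕ k) 1 (there (here refl))
      (at-wrap 0 (toℕ i) _ eq) (at-wrap 1 (toℕ i) _ eq)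

    covers-suc-k : ∀ i → Covers E (ws (toℕ i)) (e (i ⊕ suc k))
    covers-suc-k i with ⊕-unwrap i (suc k) (s≤s (ℕ.m≤m+n k k))
    ... | inj₁ eq = covers (toℕ i) (i ⊕ suc k) 1 (there (here refl))
      (at-unwrap 1 (toℕ i) _ (trans (sym (ℕ.+-suc _ k)) eq))
      (at-unwrap 2 (toℕ i) _ (trans (sym (ℕ.+-suc _ k)) eq))
    ... | inj₂ eq = covers (toℕ i) (i ⊕ suc k) 2 (there (there (here refl)))
      (at-wrap 0 (suc (toℕ i)) _ (trans (sym (ℕ.+-suc _ k)) eq))
      (at-wrap 1 (suc (toℕ i)) _ (trans (sym (ℕ.+-suc _ k)) eq))

  -- From an odd cycle to an antiperiodic walk.

  record Loop : Set where
    constructor loop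
    field
      {base next} : Pair E
      arc         : Parallel E base next
      rest        : next ⟶ swap E base
  open Loop

  length : ∀ {p q} → p ⟶ q → ℕ
  length = Star.fold (λ _ _ → ℕ) (λ _ → suc) 0

  vertex : ∀ {p q} → p ⟶ q → ℕ → Pair E
  vertex {p} _ zero          = p
  vertex {p} ε (suc t)       = p
  vertex     (_ ◅ π) (suc t) = vertex π t

  vertex-end : ∀ {p q} (π : p ⟶ q) → vertex π (length π) ≡ q
  vertex-end ε       = refl
  vertex-end (_ ◅ π) = vertex-end π

  length-snoc : ∀ {p q r} (π : p ⟶ q) (i : Parallel E q r) → length (π ◅◅ (i ◅ ε)) ≡ suc (length π)
  length-snoc ε       i = refl
  length-snoc (_ ◅ π) i = cong suc (length-snoc π i)

  vertex-snoc : ∀ {p q r} (π : p ⟶ q) (i : Parallel E q r) {t} → t ℕ.≤ length π →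
    vertex (π ◅◅ (i ◅ ε)) t ≡ vertex π t
  vertex-snoc ε       i z≤n       = refl
  vertex-snoc (_ ◅ π) i z≤n       = refl
  vertex-snoc (_ ◅ π) i (s≤s t≤)  = vertex-snoc π i t≤

  -- The end point is generalised so that the path can be matched on.
  record Rotation {p q e} (i : Parallel E p q) (π : q ⟶ e) : Set where
    field
      rotated     : Loop
      base≡       : base rotated ≡ q
      length≡     : length (rest rotated) ≡ length π
      vertex≡     : ∀ {t} → t ℕ.≤ length π →
                    vertex (arc rotated ◅ rest rotated) t ≡ vertex π t
      length≥1    : 1 ℕ.≤ length π

  -- The first arc is dropped and its reversal appended. The rest is never empty, since parallel
  -- pairs lie on different sides; this yields k ≥ 1.
  rotation : ∀ {p q e} (i : Parallel E p q) (π : q ⟶ e) → e ≡ swap E p → Rotation i π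
  rotation {p} i ε       refl = ⊥-elim (¬parallel-swap p i)
  rotation i (j ◅ π) refl = record
    { rotated  = loop j (π ◅◅ (parallel-swap E i ◅ ε))
    ; base≡    = refl
    ; length≡  = length-snoc π _
    ; vertex≡  = vertex-snoc (j ◅ π) _
    ; length≥1 = s≤s z≤n
    }

  -- The walk lists the bases of successive rotations. Its start traces the loop itself, which ends
  -- at the reversal of the base; for later times the same holds of the rotated loop.
  loop⇒antiperiodic : Loop → AntiperiodicWalk
  loop⇒antiperiodic L = record
    { k = length (rest L) ; k≥1 = length≥1 (turn L) ; at = orbit L
    ; parallel = orbit-parallel L ; antiperiodic = λ t → orbit-antiperiodic L t refl }
    where
    open Rotation
    turn : (L : Loop) → Rotation (arc L) (rest L)
    turn L = rotation (arc L) (rest L) refl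

    orbit : Loop → ℕ → Pair E
    orbit L zero    = base L
    orbit L (suc t) = orbit (rotated (turn L)) t

    orbit-parallel : ∀ L t → Parallel E (orbit L t) (orbit L (suc t))
    orbit-parallel L zero    = subst (Parallel E (base L)) (sym (base≡ (turn L))) (arc L)
    orbit-parallel L (suc t) = orbit-parallel (rotated (turn L)) t

    orbit-vertex : ∀ L {t} → t ℕ.≤ suc (length (rest L)) → orbit L t ≡ vertex (arc L ◅ rest L) t
    orbit-vertex L {zero}  _        = refl
    orbit-vertex L {suc t} (s≤s t≤) = trans
      (orbit-vertex (rotated (turn L)) (ℕ.m≤n⇒m≤1+n (subst (t ℕ.≤_) (sym (length≡ (turn L))) t≤)))
      (vertex≡ (turn L) t≤)

    -- `l` is kept as a variable since rotation preserves the length only up to a proof.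
    orbit-antiperiodic : ∀ L t {l} → length (rest L) ≡ l → orbit L (t + suc l) ≡ swap E (orbit L t)
    orbit-antiperiodic L zero    refl = trans (orbit-vertex L ℕ.≤-refl) (vertex-end (rest L))
    orbit-antiperiodic L (suc t) eq   =
      orbit-antiperiodic (rotated (turn L)) t (trans (length≡ (turn L)) eq)

  -- An edge of G⁺ is a reversal preceded by at most one parallel step, so what matters along a
  -- cycle is the parity of the number of reversals.
  adj⁺⇒⟶ : ∀ {p q} → Adj⁺ E p q → p ⟶ swap E q
  adj⁺⇒⟶ {p} (inj₁ (_ , _ , refl)) = subst (p ⟶_) (sym (swap-involutive E p)) ε
  adj⁺⇒⟶ {p} {q} (inj₂ (_ , _ , i)) =
    subst (IndepAdj E p) (sym (swap-involutive E q)) i ◅ ε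

  oddCycle⇒loop : OddCycle⁺ E → Loop
  oddCycle⇒loop C = toLoop closed refl
    where
    open OddCycle⁺ C
    N : ℕ
    N = suc (k + k)
    node : ℕ → Fin N
    node t = fromℕ< (m%n<n t N)

    node-suc : ∀ t → node t ⊕ 1 ≡ node (suc t)
    node-suc t = Fin.fromℕ<-cong _ _ (trans
      (cong (λ x → (x + 1) % N) (Fin.toℕ-fromℕ< (m%n<n t N)))
      (trans (%-distribˡ-+ (t % N) 1 N) (trans (cong (λ x → (x + 1 % N) % N) (m%n%n≡m%n t N))
        (trans (sym (%-distribˡ-+ t 1 N)) (cong (_% N) (ℕ.+-comm t 1)))))) _ _

    hop : ∀ t → vert (node t) ⟶ swap E (vert (node (suc t)))
    hop t = adj⁺⇒⟶ (subst (λ j → Adj⁺ E (vert (node t)) (vert j)) (node-suc t)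
                          (adjacent (node t)))

    -- The second of two hops is taken reversed, so the reversals cancel in pairs; the last of the
    -- 2k + 1 hops leaves one over.
    even : ∀ j → vert (node 0) ⟶ vert (node (j + j))
    even zero    = ε
    even (suc j) = subst (λ t → vert (node 0) ⟶ vert (node (suc t))) (sym (ℕ.+-suc j j))
      (even j ◅◅ hop (j + j) ◅◅
       subst (swap E (vert (node (suc (j + j)))) ⟶_)
             (swap-involutive E (vert (node (suc (suc (j + j))))))
             (⇉-swap E (hop (suc (j + j)))))

    closed : vert (node 0) ⟶ swap E (vert (node 0))
    closed = subst (λ j → vert (node 0) ⟶ swap E (vert j))
      (Fin.fromℕ<-cong _ _ (n%n≡0 N) (m%n<n N N) (m%n<n 0 N)) (even k ◅◅ hop (k + k))

    swap-≢ : ∀ {p} → InF E p → p ≢ swap E p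
    swap-≢ {pX u .u} u≢v refl = u≢v refl
    swap-≢ {pY w .w} w≢z refl = w≢z refl

    node-inF : InF E (vert (node 0))
    node-inF with adjacent (node 0)
    ... | inj₁ (p∈F , _) = p∈F
    ... | inj₂ (p∈F , _) = p∈F

    -- An empty path would make a pair of 𝓕 equal to its own reversal.
    toLoop : ∀ {e} → vert (node 0) ⟶ e → e ≡ swap E (vert (node 0)) → Loop
    toLoop ε       eq   = ⊥-elim (swap-≢ node-inF eq)
    toLoop (i ◅ π) refl = loop i π

theorem4p1 : ∀ (m n : ℕ) (E : Fin m → Fin n → Bool) →
    (CocomparabilityBigraph E ⇔ Bipartite⁺ E) ×
    (¬ Bipartite⁺ E → (C : OddCycle⁺ E) → WeakEdgeAsteroid E)
theorem4p1 m n E =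
  mk⇔ (cocomparability⇒bipartite⁺ E) (bipartite⁺⇒cocomparability E) ,
  λ _ C → antiperiodic⇒asteroid E (loop⇒antiperiodic E (oddCycle⇒loop E C))
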